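{- Let $\mathbb{A}$ be a symmetric strict monoidal category with braiding $\sigma$, and let $\mathcal{C}(\mathbb{A})$ be its free cornering. For every cell $\alpha$ of $\mathcal{C}(\mathbb{A})$, with top boundary $A$, bottom boundary $B$, left boundary $X$ and right boundary $Y$, and every object $C$ of $\mathbb{A}$, the crossing cells $\chi_{C,X},\chi_{C,Y}$ satisfy $$\frac{\chi_{C,X}\,\vert\,\alpha}{\ulcorner\sigma_{C,B}\urcorner}\;=\;\frac{\ulcorner\sigma_{C,A}\urcorner}{\alpha\,\vert\,\chi_{C,Y}} .$$
   Context: Single-object double categories. A single-object double category $\mathbb{D}$ consists of a monoid $(\mathbb{D}_H,\otimes,I)$ of horizontal edges, a monoid $(\mathbb{D}_V,\otimes,I)$ of vertical edges, and cells $\alpha$, each with a top and a bottom boundary in $\mathbb{D}_H$ and a left and a right boundary in $\mathbb{D}_V$. If the right boundary of $\alpha$ equals the left boundary of $\beta$ there is a horizontal composite $\alpha\vert\beta$ (top/bottom boundaries are multiplied in the order $\alpha,\beta$; left boundary that of $\alpha$, right boundary that of $\beta$). If the bottom boundary of $\alpha$ equals the top boundary of $\beta$ there is a vertical composite $\frac{\alpha}{\beta}$ (left/right boundaries multiplied in the order $\alpha,\beta$; top that of $\alpha$, bottom that of $\beta$). Both compositions are associative and unital, with identity cells $1_A$ for $A\in\mathbb{D}_H$ (top $=$ bottom $=A$, left $=$ right $=I$; identities for vertical composition) and $1_X$ for $X\in\mathbb{D}_V$ (left $=$ right $=X$, top $=$ bottom $=I$; identities for horizontal composition), with $1_A\vert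 1_B=1_{A\otimes B}$, $\frac{1_X}{1_Y}=1_{X\otimes Y}$, the two identity cells on $I$ coincide, and the interchange law $\frac{\alpha}{\beta}\big\vert\frac{\gamma}{\delta}=\frac{\alpha\vert\gamma}{\beta\vert\delta}$ holds. Free cornering. For a symmetric strict monoidal category $\mathbb{A}$ (with object set $\mathbb{A}_0$ and braiding $\sigma_{A,B}:A\otimes B\to B\otimes A$), $\mathcal{C}(\mathbb{A})$ is the free single-object double category determined by: horizontal edge monoid $(\mathbb{A}_0,\otimes,I)$; vertical edge monoid the free monoid $\mathbb{A}^{\circ\bullet}=(\mathbb{A}_0\times\{\circ,\bullet\})^*$, with generators written $A^\circ$, $A^\bullet$, product written $\otimes$ and unit $I$; generating cells, for each $A\in\mathbb{A}_0$, the corners (boundaries not mentioned are $I$) - $s^\circ_A$: top $A$, right $A^\circ$; $\quad r^\circ_A$: left $A^\circ$, bottom $A$; - $s^\bullet_A$: top $A$, left $A^\bullet$; $\quad r^\bullet_A$: right $A^\bullet$, bottom $A$; and, for each morphism $f:A\to B$ of $\mathbb{A}$, a cell $\ulcorner f\urcorner$ with top $A$, bottom $B$; subject to the yanking equations $s^\circ_A\vert r^\circ_A=1_A$, $\frac{r^\circ_A}{s^\circ_A}=1_{A^\circ}$, $r^\bullet_A\vert s^\bullet_A=1_A$, $\frac{r^\bullet_A}{s^\bullet_A}=1_{A^\bullet}$, and the equations $\frac{\ulcorner f\urcorner}{\ulcorner g\urcorner}=\ulcorner f;g\urcorner$ (for composable $f,g$; $f;g$ is "first $f$ then $g$"), $\ulcorner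 1_A\urcorner=1_A$, $\ulcorner f\urcorner\vert\ulcorner g\urcorner=\ulcorner f\otimes g\urcorner$. Crossing cells. For $C\in\mathbb{A}_0$ and $X\in\mathbb{A}^{\circ\bullet}$, the crossing cell $\chi_{C,X}$ (top $=$ bottom $=C$, left $=$ right $=X$) is defined inductively: $\chi_{C,A^\circ}$ is the vertical composite, from top to bottom, of $r^\circ_A\vert 1_C$, $\ulcorner\sigma_{A,C}\urcorner$, $1_C\vert s^\circ_A$; $\chi_{C,A^\bullet}$ is the vertical composite, from top to bottom, of $1_C\vert r^\bullet_A$, $\ulcorner\sigma_{C,A}\urcorner$, $s^\bullet_A\vert 1_C$; $\chi_{C,I}=1_C$; and $\chi_{C,X\otimes Y}=\frac{\chi_{C,X}}{\chi_{C,Y}}$. -}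

module Defs where

open import Level using (Level; _⊔_) renaming (suc to lsuc)
open import Algebra.Structures using (IsMonoid)
open import Data.List using (List; []; _∷_; [_]; _++_)
open import Data.List.Properties using (++-assoc; ++-identityʳ)
open import Data.Product using (_×_; _,_)
open import Relation.Binary using (IsEquivalence)
open import Relation.Binary.PropositionalEquality
  using (_≡_; refl; sym; trans; cong₂; subst₂)

-- Objects are compared by _≡_ and form a strict monoid; morphisms with given
-- domain and codomain form a setoid.  The strictness equations for morphisms
-- only typecheck after transport along the monoid laws for objects.
-- Composition is in diagrammatic order: f ⨾ g is "first f then g".
record SymmetricStrictMonoidalCategory (o ℓ e : Level) : Set (lsuc (o ⊔ ℓ ⊔ e)) where
  infix  4 _≈_
  infixr 5 _⨾_
  infixr 7 _⊗_ _⊗₁_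
  field
    Obj           : Set o
    Hom           : Obj → Obj → Set ℓ
    _≈_           : ∀ {A B} → Hom A B → Hom A B → Set e
    isEquivalence : ∀ {A B} → IsEquivalence (_≈_ {A} {B})

    id        : ∀ A → Hom A A
    _⨾_       : ∀ {A B C} → Hom A B → Hom B C → Hom A C
    ⨾-cong    : ∀ {A B C} {f f′ : Hom A B} {g g′ : Hom B C} →
                f ≈ f′ → g ≈ g′ → f ⨾ g ≈ f′ ⨾ g′
    ⨾-assoc   : ∀ {A B C D} (f : Hom A B) (g : Hom B C) (h : Hom C D) →
                (f ⨾ g) ⨾ h ≈ f ⨾ (g ⨾ h)
    identityˡ : ∀ {A B} (f : Hom A B) → id A ⨾ f ≈ f
    identityʳ : ∀ {A B} (f : Hom A B) → f ⨾ id B ≈ f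

    _⊗_        : Obj → Obj → Obj
    I          : Obj
    ⊗-isMonoid : IsMonoid _≡_ _⊗_ I

  open IsMonoid ⊗-isMonoid public
    using ()
    renaming (assoc to ⊗-assoc; identityˡ to ⊗-identityˡ; identityʳ to ⊗-identityʳ)

  field
    _⊗₁_    : ∀ {A B A′ B′} → Hom A B → Hom A′ B′ → Hom (A ⊗ A′) (B ⊗ B′)
    ⊗₁-cong : ∀ {A B A′ B′} {f f′ : Hom A B} {g g′ : Hom A′ B′} →
              f ≈ f′ → g ≈ g′ → f ⊗₁ g ≈ f′ ⊗₁ g′
    ⊗₁-id   : ∀ A B → id A ⊗₁ id B ≈ id (A ⊗ B)
    ⊗₁-⨾    : ∀ {A B C A′ B′ C′}
              (f : Hom A B) (g : Hom B C) (f′ : Hom A′ B′) (g′ : Hom B′ C′) →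
              (f ⨾ g) ⊗₁ (f′ ⨾ g′) ≈ (f ⊗₁ f′) ⨾ (g ⊗₁ g′)

    ⊗₁-assoc     : ∀ {A B A′ B′ A″ B″} (f : Hom A B) (g : Hom A′ B′) (h : Hom A″ B″) →
                   subst₂ Hom (⊗-assoc A A′ A″) (⊗-assoc B B′ B″) ((f ⊗₁ g) ⊗₁ h)
                     ≈ f ⊗₁ (g ⊗₁ h)
    ⊗₁-identityˡ : ∀ {A B} (f : Hom A B) →
                   subst₂ Hom (⊗-identityˡ A) (⊗-identityˡ B) (id I ⊗₁ f) ≈ f
    ⊗₁-identityʳ : ∀ {A B} (f : Hom A B) →
                   subst₂ Hom (⊗-identityʳ A) (⊗-identityʳ B) (f ⊗₁ id I) ≈ f

    σ            : ∀ A B → Hom (A ⊗ B) (B ⊗ A)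
    σ-natural    : ∀ {A B A′ B′} (f : Hom A B) (g : Hom A′ B′) →
                   (f ⊗₁ g) ⨾ σ B B′ ≈ σ A A′ ⨾ (g ⊗₁ f)
    σ-involutive : ∀ A B → σ A B ⨾ σ B A ≈ id (A ⊗ B)
    σ-unit       : ∀ A → subst₂ Hom (⊗-identityʳ A) (⊗-identityˡ A) (σ A I) ≈ id A
    σ-hexagon    : ∀ A B C →
                   subst₂ Hom (⊗-assoc A B C) (⊗-assoc B A C) (σ A B ⊗₁ id C)
                     ⨾ subst₂ Hom refl (sym (⊗-assoc B C A)) (id B ⊗₁ σ A C)
                     ≈ σ A (B ⊗ C)

data Polarity : Set where
  ∘ ∙ : Polarity

module FreeCornering {o ℓ e} (𝔸 : SymmetricStrictMonoidalCategory o ℓ e) where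
  open SymmetricStrictMonoidalCategory 𝔸 renaming (_≈_ to _≈ₕ_)

  VEdge : Set o
  VEdge = List (Obj × Polarity)

  infixr 6 _∣_
  infixr 5 _over_
  infix  4 _≈_

  -- Cell A B X Y consists of the terms for cells with top A, bottom B, left X
  -- and right Y; the cells of the free cornering are these terms modulo _≈_.
  -- α over β is the vertical composite with α on top.
  data Cell : Obj → Obj → VEdge → VEdge → Set (o ⊔ ℓ) where
    1ᴴ     : ∀ A → Cell A A [] []
    1ⱽ     : ∀ X → Cell I I X X
    _∣_    : ∀ {A B A′ B′ X Y Z} →
             Cell A B X Y → Cell A′ B′ Y Z → Cell (A ⊗ A′) (B ⊗ B′) X Z
    _over_ : ∀ {A B C X Y X′ Y′} →
             Cell A B X Y → Cell B C X′ Y′ → Cell A C (X ++ X′) (Y ++ Y′)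
    s∘     : ∀ A → Cell A I [] [ A , ∘ ]
    r∘     : ∀ A → Cell I A [ A , ∘ ] []
    s∙     : ∀ A → Cell A I [ A , ∙ ] []
    r∙     : ∀ A → Cell I A [] [ A , ∙ ]
    ⌜_⌝    : ∀ {A B} → Hom A B → Cell A B [] []

  -- The double category congruence.  It relates terms whose boundaries may be
  -- different expressions, since the two sides of e.g. ∣-assoc have boundaries
  -- that are only propositionally equal; ≈⇒boundaries below shows that related
  -- terms always have equal boundaries.
  data _≈_ : ∀ {A B X Y A′ B′ X′ Y′} →
             Cell A B X Y → Cell A′ B′ X′ Y′ → Set (o ⊔ ℓ ⊔ e) where
    ≈-refl  : ∀ {A B X Y} {α : Cell A B X Y} → α ≈ α
    ≈-sym   : ∀ {A B X Y A′ B′ X′ Y′} {α : Cell A B X Y} {β : Cell A′ B′ X′ Y′} →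
              α ≈ β → β ≈ α
    ≈-trans : ∀ {A B X Y A′ B′ X′ Y′ A″ B″ X″ Y″}
              {α : Cell A B X Y} {β : Cell A′ B′ X′ Y′} {γ : Cell A″ B″ X″ Y″} →
              α ≈ β → β ≈ γ → α ≈ γ

    ∣-cong    : ∀ {A B C D X Y Z A′ B′ C′ D′ X′ Y′ Z′}
                {α  : Cell A  B  X  Y}  {β  : Cell C  D  Y  Z}
                {α′ : Cell A′ B′ X′ Y′} {β′ : Cell C′ D′ Y′ Z′} →
                α ≈ α′ → β ≈ β′ → α ∣ β ≈ α′ ∣ β′
    over-cong : ∀ {A B C X Y Z W A′ B′ C′ X′ Y′ Z′ W′}
                {α  : Cell A  B  X  Y}  {β  : Cell B  C  Z  W}
                {α′ : Cell A′ B′ X′ Y′} {β′ : Cell B′ C′ Z′ W′} →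
                α ≈ α′ → β ≈ β′ → α over β ≈ α′ over β′
    ⌜⌝-cong   : ∀ {A B} {f g : Hom A B} → f ≈ₕ g → ⌜ f ⌝ ≈ ⌜ g ⌝

    ∣-assoc        : ∀ {A B C D E F X Y Z W}
                     (α : Cell A B X Y) (β : Cell C D Y Z) (γ : Cell E F Z W) →
                     (α ∣ β) ∣ γ ≈ α ∣ (β ∣ γ)
    ∣-identityˡ    : ∀ {A B X Y} (α : Cell A B X Y) → 1ⱽ X ∣ α ≈ α
    ∣-identityʳ    : ∀ {A B X Y} (α : Cell A B X Y) → α ∣ 1ⱽ Y ≈ α
    over-assoc     : ∀ {A B C D X Y X′ Y′ X″ Y″}
                     (α : Cell A B X Y) (β : Cell B C X′ Y′) (γ : Cell C D X″ Y″) →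
                     (α over β) over γ ≈ α over (β over γ)
    over-identityˡ : ∀ {A B X Y} (α : Cell A B X Y) → 1ᴴ A over α ≈ α
    over-identityʳ : ∀ {A B X Y} (α : Cell A B X Y) → α over 1ᴴ B ≈ α
    1ᴴ-⊗           : ∀ A B → 1ᴴ A ∣ 1ᴴ B ≈ 1ᴴ (A ⊗ B)
    1ⱽ-++          : ∀ X Y → 1ⱽ X over 1ⱽ Y ≈ 1ⱽ (X ++ Y)
    1ᴴ≈1ⱽ          : 1ᴴ I ≈ 1ⱽ []
    interchange    : ∀ {A B C A′ B′ C′ X Y Z X′ Y′ Z′}
                     (α : Cell A  B  X Y) (β : Cell B  C  X′ Y′)
                     (γ : Cell A′ B′ Y Z) (δ : Cell B′ C′ Y′ Z′) →
                     (α over β) ∣ (γ over δ) ≈ (α ∣ γ) over (β ∣ δ)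

    yank-∘∣    : ∀ A → s∘ A ∣ r∘ A ≈ 1ᴴ A
    yank-∘over : ∀ A → r∘ A over s∘ A ≈ 1ⱽ [ A , ∘ ]
    yank-∙∣    : ∀ A → r∙ A ∣ s∙ A ≈ 1ᴴ A
    yank-∙over : ∀ A → r∙ A over s∙ A ≈ 1ⱽ [ A , ∙ ]

    ⌜⌝-⨾  : ∀ {A B C} (f : Hom A B) (g : Hom B C) → ⌜ f ⌝ over ⌜ g ⌝ ≈ ⌜ f ⨾ g ⌝
    ⌜⌝-id : ∀ A → ⌜ id A ⌝ ≈ 1ᴴ A
    ⌜⌝-⊗₁ : ∀ {A B A′ B′} (f : Hom A B) (g : Hom A′ B′) →
            ⌜ f ⌝ ∣ ⌜ g ⌝ ≈ ⌜ f ⊗₁ g ⌝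

  ≈⇒boundaries : ∀ {A B X Y A′ B′ X′ Y′} {α : Cell A B X Y} {β : Cell A′ B′ X′ Y′} →
                 α ≈ β → A ≡ A′ × B ≡ B′ × X ≡ X′ × Y ≡ Y′
  ≈⇒boundaries ≈-refl = refl , refl , refl , refl
  ≈⇒boundaries (≈-sym p) with ≈⇒boundaries p
  ... | a , b , x , y = sym a , sym b , sym x , sym y
  ≈⇒boundaries (≈-trans p q) with ≈⇒boundaries p | ≈⇒boundaries q
  ... | a , b , x , y | a′ , b′ , x′ , y′ =
    trans a a′ , trans b b′ , trans x x′ , trans y y′
  ≈⇒boundaries (∣-cong p q) with ≈⇒boundaries p | ≈⇒boundaries q
  ... | a , b , x , _ | a′ , b′ , _ , y′ = cong₂ _⊗_ a a′ , cong₂ _⊗_ b b′ , x , y′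
  ≈⇒boundaries (over-cong p q) with ≈⇒boundaries p | ≈⇒boundaries q
  ... | a , _ , x , y | _ , b′ , x′ , y′ = a , b′ , cong₂ _++_ x x′ , cong₂ _++_ y y′
  ≈⇒boundaries (⌜⌝-cong _) = refl , refl , refl , refl
  ≈⇒boundaries (∣-assoc _ _ _) = ⊗-assoc _ _ _ , ⊗-assoc _ _ _ , refl , refl
  ≈⇒boundaries (∣-identityˡ _) = ⊗-identityˡ _ , ⊗-identityˡ _ , refl , refl
  ≈⇒boundaries (∣-identityʳ _) = ⊗-identityʳ _ , ⊗-identityʳ _ , refl , refl
  ≈⇒boundaries (over-assoc {X = X} {Y = Y} _ _ _) =
    refl , refl , ++-assoc X _ _ , ++-assoc Y _ _
  ≈⇒boundaries (over-identityˡ _) = refl , refl , refl , refl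
  ≈⇒boundaries (over-identityʳ _) = refl , refl , ++-identityʳ _ , ++-identityʳ _
  ≈⇒boundaries (1ᴴ-⊗ _ _) = refl , refl , refl , refl
  ≈⇒boundaries (1ⱽ-++ _ _) = refl , refl , refl , refl
  ≈⇒boundaries 1ᴴ≈1ⱽ = refl , refl , refl , refl
  ≈⇒boundaries (interchange _ _ _ _) = refl , refl , refl , refl
  ≈⇒boundaries (yank-∘∣ _) = ⊗-identityʳ _ , ⊗-identityˡ _ , refl , refl
  ≈⇒boundaries (yank-∘over _) = refl , refl , refl , refl
  ≈⇒boundaries (yank-∙∣ _) = ⊗-identityˡ _ , ⊗-identityʳ _ , refl , refl
  ≈⇒boundaries (yank-∙over _) = refl , refl , refl , refl
  ≈⇒boundaries (⌜⌝-⨾ _ _) = refl , refl , refl , refl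
  ≈⇒boundaries (⌜⌝-id _) = refl , refl , refl , refl
  ≈⇒boundaries (⌜⌝-⊗₁ _ _) = refl , refl , refl , refl

  castᴴ : ∀ {A B A′ B′ X Y} → A ≡ A′ → B ≡ B′ → Cell A B X Y → Cell A′ B′ X Y
  castᴴ {X = X} {Y = Y} = subst₂ (λ A B → Cell A B X Y)

  χ₁ : ∀ C (G : Obj × Polarity) → Cell C C [ G ] [ G ]
  χ₁ C (A , ∘) = castᴴ (⊗-identityˡ C) (⊗-identityʳ C)
    ((r∘ A ∣ 1ᴴ C) over ⌜ σ A C ⌝ over (1ᴴ C ∣ s∘ A))
  χ₁ C (A , ∙) = castᴴ (⊗-identityʳ C) (⊗-identityˡ C)
    ((1ᴴ C ∣ r∙ A) over ⌜ σ C A ⌝ over (s∙ A ∣ 1ᴴ C))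

  -- A vertical edge is a word in the generators, so the clauses for I and for
  -- X ⊗ Y amount to recursion on the word; up to _≈_, χ C [ G ] is χ₁ C G and
  -- χ C (X ++ Y) is χ C X over χ C Y by the unit and associativity laws.
  χ : ∀ C X → Cell C C X X
  χ C []      = 1ᴴ C
  χ C (G ∷ X) = χ₁ C G over χ C X

-- Structural induction on α.  Vertical composites paste along σ, horizontal
-- composites are the hexagon, and ⌜ f ⌝ is naturality of σ.  For a corner, one
-- side contains the crossing of a single generator; interchange brings the
-- given corner next to the opposite corner inside that crossing and yanking
-- removes both.  For s∘ and r∘ the braiding that remains is inverse to the
-- outer one; for s∙ and r∙ it is the braiding of the other side.
module Submission where

open import Defs

open import Data.List using ([]; _∷_; [_]; _++_)
open import Data.Product using (_,_)
open import Relation.Binary using (module IsEquivalence)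
open import Relation.Binary.PropositionalEquality
  using (_≡_; refl; sym; subst₂)

module Crossing {o ℓ e} (𝔸 : SymmetricStrictMonoidalCategory o ℓ e) where
  open SymmetricStrictMonoidalCategory 𝔸 hiding (_≈_)
  open FreeCornering 𝔸

  -- Equational reasoning for cells

  infix  1 begin_
  infixr 2 step-≈
  infix  3 _∎

  begin_ : ∀ {A B X Y A′ B′ X′ Y′} {α : Cell A B X Y} {β : Cell A′ B′ X′ Y′} →
           α ≈ β → α ≈ β
  begin p = p

  -- The boundaries may change from term to term because `_≈_` relates cells of different types, so
  -- associativity and unit laws enter a chain without transports.
  step-≈ : ∀ {A B X Y A′ B′ X′ Y′ A″ B″ X″ Y″}
           (α : Cell A B X Y) {β : Cell A′ B′ X′ Y′} {γ : Cell A″ B″ X″ Y″} →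
           β ≈ γ → α ≈ β → α ≈ γ
  step-≈ _ q p = ≈-trans p q

  syntax step-≈ α q p = α ≈⟨ p ⟩ q

  _∎ : ∀ {A B X Y} (α : Cell A B X Y) → α ≈ α
  _ ∎ = ≈-refl

  -- Transports and horizontal units

  -- Stated for equations between arbitrary objects so that matching on `refl` succeeds; the monoid
  -- laws it is applied to could not be matched directly.
  castᴴ-≈ : ∀ {A B A′ B′ X Y} (p : A ≡ A′) (q : B ≡ B′) (α : Cell A B X Y) →
            castᴴ p q α ≈ α
  castᴴ-≈ refl refl _ = ≈-refl

  ⌜subst₂⌝ : ∀ {A B A′ B′} (p : A ≡ A′) (q : B ≡ B′) (f : Hom A B) →
             ⌜ subst₂ Hom p q f ⌝ ≈ ⌜ f ⌝
  ⌜subst₂⌝ refl refl _ = ≈-refl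

  1ᴴ-cong : ∀ {A B} → A ≡ B → 1ᴴ A ≈ 1ᴴ B
  1ᴴ-cong refl = ≈-refl

  -- The two identity cells on `I` coincide, which makes `1ᴴ I` the horizontal unit at the empty
  -- vertical edge.
  1ᴴI-∣ : ∀ {A B Y} (α : Cell A B [] Y) → 1ᴴ I ∣ α ≈ α
  1ᴴI-∣ α = ≈-trans (∣-cong 1ᴴ≈1ⱽ ≈-refl) (∣-identityˡ α)

  ∣-1ᴴI : ∀ {A B X} (α : Cell A B X []) → α ∣ 1ᴴ I ≈ α
  ∣-1ᴴI α = ≈-trans (∣-cong ≈-refl 1ᴴ≈1ⱽ) (∣-identityʳ α)

  -- The braiding as a cell

  ⌜σ-unit⌝ : ∀ C → ⌜ σ C I ⌝ ≈ 1ᴴ C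
  ⌜σ-unit⌝ C = begin
    ⌜ σ C I ⌝                                             ≈⟨ ≈-sym (⌜subst₂⌝ (⊗-identityʳ C) (⊗-identityˡ C) (σ C I)) ⟩
    ⌜ subst₂ Hom (⊗-identityʳ C) (⊗-identityˡ C) (σ C I) ⌝ ≈⟨ ⌜⌝-cong (σ-unit C) ⟩
    ⌜ id C ⌝                                              ≈⟨ ⌜⌝-id C ⟩
    1ᴴ C                                                  ∎

  over-σ-unit : ∀ {A X Y} C (α : Cell A (C ⊗ I) X Y) → α over ⌜ σ C I ⌝ ≈ α
  over-σ-unit C α = ≈-trans
    -- The identity cell is reindexed from `C` to `C ⊗ I`, since the parts of a vertical composite
    -- must share their middle edge on the nose.
    (over-cong ≈-refl (≈-trans (⌜σ-unit⌝ C) (1ᴴ-cong (sym (⊗-identityʳ C)))))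
    (over-identityʳ α)

  σ-unit-over : ∀ {B X Y} C (α : Cell (I ⊗ C) B X Y) → ⌜ σ C I ⌝ over α ≈ α
  σ-unit-over C α = ≈-trans
    (over-cong (≈-trans (⌜σ-unit⌝ C) (1ᴴ-cong (sym (⊗-identityˡ C)))) ≈-refl)
    (over-identityˡ α)

  ⌜σ-involutive⌝ : ∀ A B → ⌜ σ A B ⌝ over ⌜ σ B A ⌝ ≈ 1ᴴ (A ⊗ B)
  ⌜σ-involutive⌝ A B = begin
    ⌜ σ A B ⌝ over ⌜ σ B A ⌝ ≈⟨ ⌜⌝-⨾ _ _ ⟩
    ⌜ σ A B ⨾ σ B A ⌝        ≈⟨ ⌜⌝-cong (σ-involutive A B) ⟩
    ⌜ id (A ⊗ B) ⌝           ≈⟨ ⌜⌝-id _ ⟩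
    1ᴴ (A ⊗ B)               ∎

  σ-over-σ-over : ∀ {A B D X Y} (α : Cell (A ⊗ B) D X Y) →
                  ⌜ σ A B ⌝ over ⌜ σ B A ⌝ over α ≈ α
  σ-over-σ-over {A} {B} α = begin
    ⌜ σ A B ⌝ over ⌜ σ B A ⌝ over α   ≈⟨ ≈-sym (over-assoc _ _ _) ⟩
    (⌜ σ A B ⌝ over ⌜ σ B A ⌝) over α ≈⟨ over-cong (⌜σ-involutive⌝ A B) ≈-refl ⟩
    1ᴴ (A ⊗ B) over α                 ≈⟨ over-identityˡ α ⟩
    α                                 ∎

  over-σ-over-σ : ∀ {A B D X Y} (α : Cell D (A ⊗ B) X Y) →
                  (α over ⌜ σ A B ⌝) over ⌜ σ B A ⌝ ≈ α
  over-σ-over-σ {A} {B} α = begin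
    (α over ⌜ σ A B ⌝) over ⌜ σ B A ⌝ ≈⟨ over-assoc _ _ _ ⟩
    α over ⌜ σ A B ⌝ over ⌜ σ B A ⌝   ≈⟨ over-cong ≈-refl (⌜σ-involutive⌝ A B) ⟩
    α over 1ᴴ (A ⊗ B)                 ≈⟨ over-identityʳ α ⟩
    α                                 ∎

  -- The factors of the hexagon, transported so that they compose.
  σ⊗id : ∀ C A B → Hom (C ⊗ (A ⊗ B)) (A ⊗ (C ⊗ B))
  σ⊗id C A B = subst₂ Hom (⊗-assoc C A B) (⊗-assoc A C B) (σ C A ⊗₁ id B)

  id⊗σ : ∀ C A B → Hom (A ⊗ (C ⊗ B)) ((A ⊗ B) ⊗ C)
  id⊗σ C A B = subst₂ Hom refl (sym (⊗-assoc A B C)) (id A ⊗₁ σ C B)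

  ⌜σ-hexagon⌝ : ∀ C A B → ⌜ σ C (A ⊗ B) ⌝ ≈ ⌜ σ⊗id C A B ⌝ over ⌜ id⊗σ C A B ⌝
  ⌜σ-hexagon⌝ C A B =
    ≈-trans (⌜⌝-cong (Hom≈.sym (σ-hexagon C A B))) (≈-sym (⌜⌝-⨾ _ _))
    where module Hom≈ {A B} = IsEquivalence (isEquivalence {A} {B})

  -- The transports in `σ⊗id` vanish because `_≈_` admits differently bracketed boundaries on its
  -- two sides.
  ⌜σ⊗id⌝ : ∀ C A B → ⌜ σ⊗id C A B ⌝ ≈ ⌜ σ C A ⌝ ∣ 1ᴴ B
  ⌜σ⊗id⌝ C A B = begin
    ⌜ σ⊗id C A B ⌝       ≈⟨ ⌜subst₂⌝ (⊗-assoc C A B) (⊗-assoc A C B) _ ⟩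
    ⌜ σ C A ⊗₁ id B ⌝    ≈⟨ ≈-sym (⌜⌝-⊗₁ _ _) ⟩
    ⌜ σ C A ⌝ ∣ ⌜ id B ⌝ ≈⟨ ∣-cong ≈-refl (⌜⌝-id B) ⟩
    ⌜ σ C A ⌝ ∣ 1ᴴ B     ∎

  ⌜id⊗σ⌝ : ∀ C A B → ⌜ id⊗σ C A B ⌝ ≈ 1ᴴ A ∣ ⌜ σ C B ⌝
  ⌜id⊗σ⌝ C A B = begin
    ⌜ id⊗σ C A B ⌝       ≈⟨ ⌜subst₂⌝ refl (sym (⊗-assoc A B C)) _ ⟩
    ⌜ id A ⊗₁ σ C B ⌝    ≈⟨ ≈-sym (⌜⌝-⊗₁ _ _) ⟩
    ⌜ id A ⌝ ∣ ⌜ σ C B ⌝ ≈⟨ ∣-cong (⌜⌝-id A) ≈-refl ⟩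
    1ᴴ A ∣ ⌜ σ C B ⌝     ∎

  -- Crossing cells and yanking

  -- Besides the transport, this removes the `1ᴴ C` with which the recursion of `χ` closes every
  -- word.
  χ-∘ : ∀ C A → χ C [ A , ∘ ] ≈ (r∘ A ∣ 1ᴴ C) over ⌜ σ A C ⌝ over (1ᴴ C ∣ s∘ A)
  χ-∘ C A = ≈-trans (over-identityʳ _) (castᴴ-≈ (⊗-identityˡ C) (⊗-identityʳ C) _)

  χ-∙ : ∀ C A → χ C [ A , ∙ ] ≈ (1ᴴ C ∣ r∙ A) over ⌜ σ C A ⌝ over (s∙ A ∣ 1ᴴ C)
  χ-∙ C A = ≈-trans (over-identityʳ _) (castᴴ-≈ (⊗-identityʳ C) (⊗-identityˡ C) _)

  χ-++ : ∀ C X Y → χ C (X ++ Y) ≈ χ C X over χ C Y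
  χ-++ C []      Y = ≈-sym (over-identityˡ _)
  χ-++ C (G ∷ X) Y = ≈-trans (over-cong ≈-refl (χ-++ C X Y)) (≈-sym (over-assoc _ _ _))

  s∘-∣-χ : ∀ C A → s∘ A ∣ χ C [ A , ∘ ] ≈ ⌜ σ A C ⌝ over (1ᴴ C ∣ s∘ A)
  s∘-∣-χ C A = begin
    s∘ A ∣ χ C [ A , ∘ ]
      -- Padding gives the corner as many layers as the crossing; `s∘ A` stays on top because its
      -- partner `r∘ A` lies in the top layer there.
      ≈⟨ ∣-cong (≈-sym (≈-trans (over-cong ≈-refl (over-identityʳ _)) (over-identityʳ _))) (χ-∘ C A) ⟩
    (s∘ A over 1ᴴ I over 1ᴴ I) ∣ ((r∘ A ∣ 1ᴴ C) over ⌜ σ A C ⌝ over (1ᴴ C ∣ s∘ A))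
      ≈⟨ interchange _ _ _ _ ⟩
    (s∘ A ∣ (r∘ A ∣ 1ᴴ C)) over ((1ᴴ I over 1ᴴ I) ∣ (⌜ σ A C ⌝ over (1ᴴ C ∣ s∘ A)))
      ≈⟨ over-cong yank (≈-trans (∣-cong (over-identityʳ _) ≈-refl) (1ᴴI-∣ _)) ⟩
    1ᴴ (A ⊗ C) over ⌜ σ A C ⌝ over (1ᴴ C ∣ s∘ A)
      ≈⟨ over-identityˡ _ ⟩
    ⌜ σ A C ⌝ over (1ᴴ C ∣ s∘ A) ∎
    where
    yank : s∘ A ∣ (r∘ A ∣ 1ᴴ C) ≈ 1ᴴ (A ⊗ C)
    yank = ≈-trans (≈-sym (∣-assoc _ _ _)) (≈-trans (∣-cong (yank-∘∣ A) ≈-refl) (1ᴴ-⊗ A C))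

  r∙-∣-χ : ∀ C A → r∙ A ∣ χ C [ A , ∙ ] ≈ (1ᴴ C ∣ r∙ A) over ⌜ σ C A ⌝
  r∙-∣-χ C A = begin
    r∙ A ∣ χ C [ A , ∙ ]
      -- The partner `s∙ A` is in the bottom layer, so the padding goes above `r∙ A`; a second
      -- interchange, in `lower`, then separates the last two layers.
      ≈⟨ ∣-cong (≈-sym (≈-trans (over-identityˡ _) (over-identityˡ _))) (χ-∙ C A) ⟩
    (1ᴴ I over 1ᴴ I over r∙ A) ∣ ((1ᴴ C ∣ r∙ A) over ⌜ σ C A ⌝ over (s∙ A ∣ 1ᴴ C))
      ≈⟨ interchange _ _ _ _ ⟩
    (1ᴴ I ∣ (1ᴴ C ∣ r∙ A)) over ((1ᴴ I over r∙ A) ∣ (⌜ σ C A ⌝ over (s∙ A ∣ 1ᴴ C)))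
      ≈⟨ over-cong (1ᴴI-∣ _) lower ⟩
    (1ᴴ C ∣ r∙ A) over ⌜ σ C A ⌝ ∎
    where
    yank : r∙ A ∣ (s∙ A ∣ 1ᴴ C) ≈ 1ᴴ (A ⊗ C)
    yank = ≈-trans (≈-sym (∣-assoc _ _ _)) (≈-trans (∣-cong (yank-∙∣ A) ≈-refl) (1ᴴ-⊗ A C))

    lower : (1ᴴ I over r∙ A) ∣ (⌜ σ C A ⌝ over (s∙ A ∣ 1ᴴ C)) ≈ ⌜ σ C A ⌝
    lower = begin
      (1ᴴ I over r∙ A) ∣ (⌜ σ C A ⌝ over (s∙ A ∣ 1ᴴ C)) ≈⟨ interchange _ _ _ _ ⟩
      (1ᴴ I ∣ ⌜ σ C A ⌝) over (r∙ A ∣ (s∙ A ∣ 1ᴴ C))   ≈⟨ over-cong (1ᴴI-∣ _) yank ⟩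
      ⌜ σ C A ⌝ over 1ᴴ (A ⊗ C)                         ≈⟨ over-identityʳ _ ⟩
      ⌜ σ C A ⌝                                         ∎

  χ-∣-r∘ : ∀ C A → χ C [ A , ∘ ] ∣ r∘ A ≈ (r∘ A ∣ 1ᴴ C) over ⌜ σ A C ⌝
  χ-∣-r∘ C A = begin
    χ C [ A , ∘ ] ∣ r∘ A
      -- The crossing ends with `s∘ A`, so `r∘ A` is padded from above.
      ≈⟨ ∣-cong (χ-∘ C A) (≈-sym (≈-trans (over-identityˡ _) (over-identityˡ _))) ⟩
    ((r∘ A ∣ 1ᴴ C) over ⌜ σ A C ⌝ over (1ᴴ C ∣ s∘ A)) ∣ (1ᴴ I over 1ᴴ I over r∘ A)
      ≈⟨ interchange _ _ _ _ ⟩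
    ((r∘ A ∣ 1ᴴ C) ∣ 1ᴴ I) over ((⌜ σ A C ⌝ over (1ᴴ C ∣ s∘ A)) ∣ (1ᴴ I over r∘ A))
      ≈⟨ over-cong (∣-1ᴴI _) lower ⟩
    (r∘ A ∣ 1ᴴ C) over ⌜ σ A C ⌝ ∎
    where
    yank : (1ᴴ C ∣ s∘ A) ∣ r∘ A ≈ 1ᴴ (C ⊗ A)
    yank = ≈-trans (∣-assoc _ _ _) (≈-trans (∣-cong ≈-refl (yank-∘∣ A)) (1ᴴ-⊗ C A))

    lower : (⌜ σ A C ⌝ over (1ᴴ C ∣ s∘ A)) ∣ (1ᴴ I over r∘ A) ≈ ⌜ σ A C ⌝
    lower = begin
      (⌜ σ A C ⌝ over (1ᴴ C ∣ s∘ A)) ∣ (1ᴴ I over r∘ A) ≈⟨ interchange _ _ _ _ ⟩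
      (⌜ σ A C ⌝ ∣ 1ᴴ I) over ((1ᴴ C ∣ s∘ A) ∣ r∘ A)   ≈⟨ over-cong (∣-1ᴴI _) yank ⟩
      ⌜ σ A C ⌝ over 1ᴴ (C ⊗ A)                         ≈⟨ over-identityʳ _ ⟩
      ⌜ σ A C ⌝                                         ∎

  χ-∣-s∙ : ∀ C A → χ C [ A , ∙ ] ∣ s∙ A ≈ ⌜ σ C A ⌝ over (s∙ A ∣ 1ᴴ C)
  χ-∣-s∙ C A = begin
    χ C [ A , ∙ ] ∣ s∙ A
      -- The crossing starts with `r∙ A`, so `s∙ A` is padded from below.
      ≈⟨ ∣-cong (χ-∙ C A) (≈-sym (≈-trans (over-cong ≈-refl (over-identityʳ _)) (over-identityʳ _))) ⟩
    ((1ᴴ C ∣ r∙ A) over ⌜ σ C A ⌝ over (s∙ A ∣ 1ᴴ C)) ∣ (s∙ A over 1ᴴ I over 1ᴴ I)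
      ≈⟨ interchange _ _ _ _ ⟩
    ((1ᴴ C ∣ r∙ A) ∣ s∙ A) over ((⌜ σ C A ⌝ over (s∙ A ∣ 1ᴴ C)) ∣ (1ᴴ I over 1ᴴ I))
      ≈⟨ over-cong yank (≈-trans (∣-cong ≈-refl (over-identityʳ _)) (∣-1ᴴI _)) ⟩
    1ᴴ (C ⊗ A) over ⌜ σ C A ⌝ over (s∙ A ∣ 1ᴴ C)
      ≈⟨ over-identityˡ _ ⟩
    ⌜ σ C A ⌝ over (s∙ A ∣ 1ᴴ C) ∎
    where
    yank : (1ᴴ C ∣ r∙ A) ∣ s∙ A ≈ 1ᴴ (C ⊗ A)
    yank = ≈-trans (∣-assoc _ _ _) (≈-trans (∣-cong ≈-refl (yank-∙∣ A)) (1ᴴ-⊗ C A))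

  -- Sliding an object past a cell

  -- The induction predicate. Its left side has vertical boundaries `X ++ []` and `Y ++ []`, its
  -- right side `X` and `Y`.
  SlidesUnder : Obj → ∀ {A B X Y} → Cell A B X Y → Set _
  SlidesUnder C {A} {B} {X} {Y} α =
    (χ C X ∣ α) over ⌜ σ C B ⌝ ≈ ⌜ σ C A ⌝ over (α ∣ χ C Y)

  module _ (C : Obj) where

    slides-1ᴴ : ∀ A → SlidesUnder C (1ᴴ A)
    slides-1ᴴ A = begin
      (1ᴴ C ∣ 1ᴴ A) over ⌜ σ C A ⌝ ≈⟨ over-cong (1ᴴ-⊗ C A) ≈-refl ⟩
      1ᴴ (C ⊗ A) over ⌜ σ C A ⌝    ≈⟨ over-identityˡ _ ⟩
      ⌜ σ C A ⌝                    ≈⟨ ≈-sym (over-identityʳ _) ⟩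
      ⌜ σ C A ⌝ over 1ᴴ (A ⊗ C)    ≈⟨ over-cong ≈-refl (≈-sym (1ᴴ-⊗ A C)) ⟩
      ⌜ σ C A ⌝ over (1ᴴ A ∣ 1ᴴ C) ∎

    -- Top and bottom are `I`, so both braidings are trivial and both sides reduce to `χ C X`.
    slides-1ⱽ : ∀ X → SlidesUnder C (1ⱽ X)
    slides-1ⱽ X = begin
      (χ C X ∣ 1ⱽ X) over ⌜ σ C I ⌝ ≈⟨ over-σ-unit C _ ⟩
      χ C X ∣ 1ⱽ X                  ≈⟨ ∣-identityʳ _ ⟩
      χ C X                         ≈⟨ ≈-sym (∣-identityˡ _) ⟩
      1ⱽ X ∣ χ C X                  ≈⟨ ≈-sym (σ-unit-over C _) ⟩
      ⌜ σ C I ⌝ over (1ⱽ X ∣ χ C X) ∎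

    -- The hexagon lets `C` pass the two factors in turn; in between, its crossing sits on the
    -- shared edge `Y`.
    slides-∣ : ∀ {A B A′ B′ X Y Z} {α : Cell A B X Y} {β : Cell A′ B′ Y Z} →
               SlidesUnder C α → SlidesUnder C β → SlidesUnder C (α ∣ β)
    slides-∣ {A} {B} {A′} {B′} {X} {Y} {Z} {α} {β} slides-α slides-β = begin
      (χ C X ∣ (α ∣ β)) over ⌜ σ C (B ⊗ B′) ⌝
        ≈⟨ over-cong ≈-refl (⌜σ-hexagon⌝ C B B′) ⟩
      (χ C X ∣ (α ∣ β)) over ⌜ σ⊗id C B B′ ⌝ over ⌜ id⊗σ C B B′ ⌝
        ≈⟨ ≈-sym (over-assoc _ _ _) ⟩
      ((χ C X ∣ (α ∣ β)) over ⌜ σ⊗id C B B′ ⌝) over ⌜ id⊗σ C B B′ ⌝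
        ≈⟨ over-cong past-α ≈-refl ⟩
      (⌜ σ⊗id C A A′ ⌝ over (α ∣ (χ C Y ∣ β))) over ⌜ id⊗σ C B B′ ⌝
        ≈⟨ over-assoc _ _ _ ⟩
      ⌜ σ⊗id C A A′ ⌝ over (α ∣ (χ C Y ∣ β)) over ⌜ id⊗σ C B B′ ⌝
        ≈⟨ over-cong ≈-refl past-β ⟩
      ⌜ σ⊗id C A A′ ⌝ over ⌜ id⊗σ C A A′ ⌝ over ((α ∣ β) ∣ χ C Z)
        ≈⟨ ≈-sym (over-assoc _ _ _) ⟩
      (⌜ σ⊗id C A A′ ⌝ over ⌜ id⊗σ C A A′ ⌝) over ((α ∣ β) ∣ χ C Z)
        ≈⟨ over-cong (≈-sym (⌜σ-hexagon⌝ C A A′)) ≈-refl ⟩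
      ⌜ σ C (A ⊗ A′) ⌝ over ((α ∣ β) ∣ χ C Z) ∎
      where
      past-α : (χ C X ∣ (α ∣ β)) over ⌜ σ⊗id C B B′ ⌝
                 ≈ ⌜ σ⊗id C A A′ ⌝ over (α ∣ (χ C Y ∣ β))
      past-α = begin
        (χ C X ∣ (α ∣ β)) over ⌜ σ⊗id C B B′ ⌝
          ≈⟨ over-cong (≈-sym (∣-assoc _ _ _)) (⌜σ⊗id⌝ C B B′) ⟩
        ((χ C X ∣ α) ∣ β) over (⌜ σ C B ⌝ ∣ 1ᴴ B′)
          ≈⟨ ≈-sym (interchange _ _ _ _) ⟩
        ((χ C X ∣ α) over ⌜ σ C B ⌝) ∣ (β over 1ᴴ B′)
          -- While `C` passes `α`, the cell `β` drops from the upper layer to the lower one.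
          ≈⟨ ∣-cong slides-α (≈-trans (over-identityʳ β) (≈-sym (over-identityˡ β))) ⟩
        (⌜ σ C A ⌝ over (α ∣ χ C Y)) ∣ (1ᴴ A′ over β)
          ≈⟨ interchange _ _ _ _ ⟩
        (⌜ σ C A ⌝ ∣ 1ᴴ A′) over ((α ∣ χ C Y) ∣ β)
          ≈⟨ over-cong (≈-sym (⌜σ⊗id⌝ C A A′)) (∣-assoc _ _ _) ⟩
        ⌜ σ⊗id C A A′ ⌝ over (α ∣ (χ C Y ∣ β)) ∎

      past-β : (α ∣ (χ C Y ∣ β)) over ⌜ id⊗σ C B B′ ⌝
                 ≈ ⌜ id⊗σ C A A′ ⌝ over ((α ∣ β) ∣ χ C Z)
      past-β = begin
        (α ∣ (χ C Y ∣ β)) over ⌜ id⊗σ C B B′ ⌝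
          ≈⟨ over-cong ≈-refl (⌜id⊗σ⌝ C B B′) ⟩
        (α ∣ (χ C Y ∣ β)) over (1ᴴ B ∣ ⌜ σ C B′ ⌝)
          ≈⟨ ≈-sym (interchange _ _ _ _) ⟩
        (α over 1ᴴ B) ∣ ((χ C Y ∣ β) over ⌜ σ C B′ ⌝)
          -- Now `α` drops a layer while `C` passes `β`.
          ≈⟨ ∣-cong (≈-trans (over-identityʳ α) (≈-sym (over-identityˡ α))) slides-β ⟩
        (1ᴴ A over α) ∣ (⌜ σ C A′ ⌝ over (β ∣ χ C Z))
          ≈⟨ interchange _ _ _ _ ⟩
        (1ᴴ A ∣ ⌜ σ C A′ ⌝) over (α ∣ (β ∣ χ C Z))
          ≈⟨ over-cong (≈-sym (⌜id⊗σ⌝ C A A′)) (≈-sym (∣-assoc _ _ _)) ⟩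
        ⌜ id⊗σ C A A′ ⌝ over ((α ∣ β) ∣ χ C Z) ∎

    slides-over : ∀ {A B D X Y X′ Y′} {α : Cell A B X Y} {β : Cell B D X′ Y′} →
                  SlidesUnder C α → SlidesUnder C β → SlidesUnder C (α over β)
    slides-over {A} {B} {D} {X} {Y} {X′} {Y′} {α} {β} slides-α slides-β = begin
      (χ C (X ++ X′) ∣ (α over β)) over ⌜ σ C D ⌝
        -- Cutting the crossing between `X` and `X′` lets interchange place each half beside its own
        -- cell.
        ≈⟨ over-cong (≈-trans (∣-cong (χ-++ C X X′) ≈-refl) (interchange _ _ _ _)) ≈-refl ⟩
      ((χ C X ∣ α) over (χ C X′ ∣ β)) over ⌜ σ C D ⌝
        ≈⟨ over-assoc _ _ _ ⟩
      (χ C X ∣ α) over (χ C X′ ∣ β) over ⌜ σ C D ⌝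
        ≈⟨ over-cong ≈-refl slides-β ⟩
      (χ C X ∣ α) over ⌜ σ C B ⌝ over (β ∣ χ C Y′)
        ≈⟨ ≈-sym (over-assoc _ _ _) ⟩
      ((χ C X ∣ α) over ⌜ σ C B ⌝) over (β ∣ χ C Y′)
        ≈⟨ over-cong slides-α ≈-refl ⟩
      (⌜ σ C A ⌝ over (α ∣ χ C Y)) over (β ∣ χ C Y′)
        ≈⟨ over-assoc _ _ _ ⟩
      ⌜ σ C A ⌝ over (α ∣ χ C Y) over (β ∣ χ C Y′)
        ≈⟨ over-cong ≈-refl (≈-sym (≈-trans (∣-cong ≈-refl (χ-++ C Y Y′)) (interchange _ _ _ _))) ⟩
      ⌜ σ C A ⌝ over ((α over β) ∣ χ C (Y ++ Y′)) ∎

    -- The bottom edge `I` makes the outer braiding trivial; an inverse pair is then inserted whose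
    -- second half is the braiding that yanking leaves on the other side.
    slides-s∘ : ∀ A → SlidesUnder C (s∘ A)
    slides-s∘ A = begin
      (1ᴴ C ∣ s∘ A) over ⌜ σ C I ⌝                  ≈⟨ over-σ-unit C _ ⟩
      1ᴴ C ∣ s∘ A                                   ≈⟨ ≈-sym (σ-over-σ-over _) ⟩
      ⌜ σ C A ⌝ over ⌜ σ A C ⌝ over (1ᴴ C ∣ s∘ A)   ≈⟨ over-cong ≈-refl (≈-sym (s∘-∣-χ C A)) ⟩
      ⌜ σ C A ⌝ over (s∘ A ∣ χ C [ A , ∘ ])         ∎

    slides-r∘ : ∀ A → SlidesUnder C (r∘ A)
    slides-r∘ A = begin
      (χ C [ A , ∘ ] ∣ r∘ A) over ⌜ σ C A ⌝             ≈⟨ over-cong (χ-∣-r∘ C A) ≈-refl ⟩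
      ((r∘ A ∣ 1ᴴ C) over ⌜ σ A C ⌝) over ⌜ σ C A ⌝     ≈⟨ over-σ-over-σ _ ⟩
      r∘ A ∣ 1ᴴ C                                       ≈⟨ ≈-sym (σ-unit-over C _) ⟩
      ⌜ σ C I ⌝ over (r∘ A ∣ 1ᴴ C)                      ∎

    slides-s∙ : ∀ A → SlidesUnder C (s∙ A)
    slides-s∙ A = begin
      (χ C [ A , ∙ ] ∣ s∙ A) over ⌜ σ C I ⌝ ≈⟨ over-σ-unit C _ ⟩
      χ C [ A , ∙ ] ∣ s∙ A                  ≈⟨ χ-∣-s∙ C A ⟩
      ⌜ σ C A ⌝ over (s∙ A ∣ 1ᴴ C)          ∎

    slides-r∙ : ∀ A → SlidesUnder C (r∙ A)
    slides-r∙ A = begin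
      (1ᴴ C ∣ r∙ A) over ⌜ σ C A ⌝          ≈⟨ ≈-sym (r∙-∣-χ C A) ⟩
      r∙ A ∣ χ C [ A , ∙ ]                  ≈⟨ ≈-sym (σ-unit-over C _) ⟩
      ⌜ σ C I ⌝ over (r∙ A ∣ χ C [ A , ∙ ]) ∎

    -- Both vertical boundaries are empty, so the crossings are `1ᴴ C`, that is `⌜ id C ⌝`, and the
    -- equation comes from one in `𝔸`.
    slides-⌜⌝ : ∀ {A B} (f : Hom A B) → SlidesUnder C ⌜ f ⌝
    slides-⌜⌝ {A} {B} f = begin
      (1ᴴ C ∣ ⌜ f ⌝) over ⌜ σ C B ⌝       ≈⟨ over-cong (∣-cong (≈-sym (⌜⌝-id C)) ≈-refl) ≈-refl ⟩
      (⌜ id C ⌝ ∣ ⌜ f ⌝) over ⌜ σ C B ⌝   ≈⟨ over-cong (⌜⌝-⊗₁ _ _) ≈-refl ⟩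
      ⌜ id C ⊗₁ f ⌝ over ⌜ σ C B ⌝        ≈⟨ ⌜⌝-⨾ _ _ ⟩
      ⌜ (id C ⊗₁ f) ⨾ σ C B ⌝             ≈⟨ ⌜⌝-cong (σ-natural (id C) f) ⟩
      ⌜ σ C A ⨾ (f ⊗₁ id C) ⌝             ≈⟨ ≈-sym (⌜⌝-⨾ _ _) ⟩
      ⌜ σ C A ⌝ over ⌜ f ⊗₁ id C ⌝        ≈⟨ over-cong ≈-refl (≈-sym (⌜⌝-⊗₁ _ _)) ⟩
      ⌜ σ C A ⌝ over (⌜ f ⌝ ∣ ⌜ id C ⌝)   ≈⟨ over-cong ≈-refl (∣-cong ≈-refl (⌜⌝-id C)) ⟩
      ⌜ σ C A ⌝ over (⌜ f ⌝ ∣ 1ᴴ C)       ∎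

    -- Cells are terms modulo `_≈_`, so recursion on terms covers every representative of every
    -- cell.
    slides : ∀ {A B X Y} (α : Cell A B X Y) → SlidesUnder C α
    slides (1ᴴ A)     = slides-1ᴴ A
    slides (1ⱽ X)     = slides-1ⱽ X
    slides (α ∣ β)    = slides-∣ (slides α) (slides β)
    slides (α over β) = slides-over (slides α) (slides β)
    slides (s∘ A)     = slides-s∘ A
    slides (r∘ A)     = slides-r∘ A
    slides (s∙ A)     = slides-s∙ A
    slides (r∙ A)     = slides-r∙ A
    slides ⌜ f ⌝      = slides-⌜⌝ f

lemma4p5 : ∀ {o ℓ e} (𝔸 : SymmetricStrictMonoidalCategory o ℓ e) →
    let open SymmetricStrictMonoidalCategory 𝔸 hiding (_≈_)
        open FreeCornering 𝔸
    in ∀ {A B : Obj} {X Y : VEdge} (α : Cell A B X Y) (C : Obj) →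
       (χ C X ∣ α) over ⌜ σ C B ⌝ ≈ ⌜ σ C A ⌝ over (α ∣ χ C Y)
lemma4p5 𝔸 α C = Crossing.slides 𝔸 C α
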